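{- Let $n\geq 3$ and let $F\subseteq V(Q_n^3)$ be a vertex cut of $Q_n^3$ (i.e. $Q_n^3-F$ is disconnected) with $|F|\leq 8n-13$. Then $Q_n^3-F$ satisfies one of the following: (1) it has exactly two components, one of which is a single vertex, or a single edge ($K_2$), or a path on three vertices, or a cycle of length $3$; (2) it has exactly three components, two of which are single vertices; (3) it has exactly three components, two of which are a single vertex and a single edge ($K_2$), respectively; (4) it has exactly four components, three of which are single vertices.
   Context: The $3$-ary $n$-cube $Q_n^3$ is the graph whose vertices are the strings $u=u_{n-1}u_{n-2}\cdots u_0$ with $u_i\in\{0,1,2\}$, two vertices $u,v$ being adjacent if and only if there is an index $j$ with $u_j=v_j\pm 1 \pmod 3$ and $u_i=v_i$ for all $i\neq j$. -}

module Defs where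

open import Data.Nat using (ℕ; _≤_; _*_; _∸_)
open import Data.Fin using (Fin; zero; suc)
open import Data.Vec using (Vec; lookup)
open import Data.List using (List; length)
open import Data.List.Membership.Propositional using (_∉_)
open import Data.List.Relation.Unary.Unique.Propositional using (Unique)
open import Data.Product using (Σ; _×_; ∃-syntax)
open import Data.Sum using (_⊎_)
open import Relation.Binary.PropositionalEquality using (_≡_; _≢_)
open import Relation.Nullary using (¬_)
open import Function.Bundles using (_⇔_)

Vertex : ℕ → Set
Vertex n = Vec (Fin 3) n

suc3 : Fin 3 → Fin 3
suc3 zero = suc zero
suc3 (suc zero) = suc (suc zero)
suc3 (suc (suc zero)) = zero

pred3 : Fin 3 → Fin 3
pred3 zero = suc (suc zero)
pred3 (suc zero) = zero
pred3 (suc (suc zero)) = suc zero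

Adj : ∀ {n} → Vertex n → Vertex n → Set
Adj {n} u v = Σ (Fin n) λ j →
  (lookup u j ≡ suc3 (lookup v j) ⊎ lookup u j ≡ pred3 (lookup v j)) ×
  (∀ i → i ≢ j → lookup u i ≡ lookup v i)

data Reach {n} (F : List (Vertex n)) : Vertex n → Vertex n → Set where
  here : ∀ {u} → u ∉ F → Reach F u u
  step : ∀ {u w v} → u ∉ F → Adj u w → Reach F w v → Reach F u v

IsVertexCut : ∀ {n} → List (Vertex n) → Set
IsVertexCut {n} F = Σ (Vertex n) λ u → Σ (Vertex n) λ v →
  u ∉ F × v ∉ F × ¬ Reach F u v

ComponentReps : ∀ {n k} → List (Vertex n) → (Fin k → Vertex n) → Set
ComponentReps {n} {k} F rs =
  (∀ i → rs i ∉ F) ×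
  (∀ i j → i ≢ j → ¬ Reach F (rs i) (rs j)) ×
  (∀ v → v ∉ F → Σ (Fin k) λ i → Reach F (rs i) v)

-- Shapes of the component of Q_n^3 - F containing r
-- (a component is an induced subgraph).
CompIsK1 : ∀ {n} → List (Vertex n) → Vertex n → Set
CompIsK1 F r = ∀ v → Reach F r v → v ≡ r

CompIsK2 : ∀ {n} → List (Vertex n) → Vertex n → Set
CompIsK2 {n} F r = Σ (Vertex n) λ a → Σ (Vertex n) λ b →
  a ≢ b × Adj a b ×
  (∀ v → Reach F r v ⇔ (v ≡ a ⊎ v ≡ b))

CompIsP3 : ∀ {n} → List (Vertex n) → Vertex n → Set
CompIsP3 {n} F r = Σ (Vertex n) λ a → Σ (Vertex n) λ b → Σ (Vertex n) λ c →
  a ≢ b × b ≢ c × a ≢ c ×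
  Adj a b × Adj b c × ¬ Adj a c ×
  (∀ v → Reach F r v ⇔ (v ≡ a ⊎ v ≡ b ⊎ v ≡ c))

CompIsK3 : ∀ {n} → List (Vertex n) → Vertex n → Set
CompIsK3 {n} F r = Σ (Vertex n) λ a → Σ (Vertex n) λ b → Σ (Vertex n) λ c →
  a ≢ b × b ≢ c × a ≢ c ×
  Adj a b × Adj b c × Adj a c ×
  (∀ v → Reach F r v ⇔ (v ≡ a ⊎ v ≡ b ⊎ v ≡ c))

f0 : ∀ {k} → Fin (Data.Nat.suc k)
f0 = zero
f1 : ∀ {k} → Fin (Data.Nat.suc (Data.Nat.suc k))
f1 = suc zero
f2 : ∀ {k} → Fin (Data.Nat.suc (Data.Nat.suc (Data.Nat.suc k)))
f2 = suc (suc zero)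

Case1 Case2 Case3 Case4 : ∀ {n} → List (Vertex n) → Set
Case1 {n} F = Σ (Fin 2 → Vertex n) λ rs → ComponentReps F rs ×
  (CompIsK1 F (rs f0) ⊎ CompIsK2 F (rs f0) ⊎ CompIsP3 F (rs f0) ⊎ CompIsK3 F (rs f0))
Case2 {n} F = Σ (Fin 3 → Vertex n) λ rs → ComponentReps F rs ×
  CompIsK1 F (rs f0) × CompIsK1 F (rs f1)
Case3 {n} F = Σ (Fin 3 → Vertex n) λ rs → ComponentReps F rs ×
  CompIsK1 F (rs f0) × CompIsK2 F (rs f1)
Case4 {n} F = Σ (Fin 4 → Vertex n) λ rs → ComponentReps F rs ×
  CompIsK1 F (rs f0) × CompIsK1 F (rs f1) × CompIsK1 F (rs f2)

{-# OPTIONS --safe #-}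

-- Let P and Q be disjoint vertex sets with no edge between them, both of at least k ≤ 4 vertices.
-- Then the remaining vertices number at least 2n, 4n-3, 6n-7, 8n-12 for k = 1, 2, 3, 4.  This goes
-- by induction on n, cutting the cube into its three layers: besides the induction hypothesis in
-- each layer only the inequalities aᵢ + bⱼ ≤ 3ⁿ are needed, where aᵢ and bⱼ count P in layer i and
-- Q in layer j, because copies of a vertex in different layers are adjacent.  Hence a closed set
-- outside a cut of at most 8n-13 vertices has at most 3 vertices or misses at most 3.  If all
-- components had at most 3 vertices, then adding them one at a time would never exceed 3 vertices,
-- so some component misses at most 3, and inspecting those gives the cases.

module Submission where

open import Defs
open import Data.Nat
open import Data.Nat.Properties
open import Data.Nat.Tactic.RingSolver using (solve-∀)
open import Data.Fin using (Fin; zero; suc)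
open import Data.Fin.Properties as Fin using (any?; all?)
open import Data.List as List using (List; []; _∷_; _++_; length; filter; map; allFin; cartesianProductWith)
open import Data.List.Properties using (length-++; filter-++; filter-all; filter-none)
open import Data.List.Membership.Propositional using (_∈_; _∉_; lose; find)
open import Data.List.Membership.Propositional.Properties
  using (∈-cartesianProductWith⁺; ∈-allFin; ∈-filter⁺; ∈-filter⁻; ∈-lookup)
import Data.List.Membership.DecPropositional as DecMembership
open import Data.List.Relation.Unary.All as All using (All; []; _∷_)
import Data.List.Relation.Unary.All.Properties as All
open import Data.List.Relation.Unary.Any as Any using (Any; here; there)
import Data.List.Relation.Unary.Any.Properties as Any
open import Data.List.Relation.Unary.AllPairs using (AllPairs; []; _∷_)
import Data.List.Relation.Unary.AllPairs.Properties as AllPairs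
open import Data.List.Relation.Unary.Unique.Propositional using (Unique)
open import Data.List.Relation.Unary.Unique.Propositional.Properties as Unique using (allFin⁺; cartesianProductWith⁺)
open import Data.Vec using ([]; _∷_; lookup)
open import Data.Vec.Properties using (∷-injective; ≡-dec)
open import Data.Product using (Σ; ∃; _×_; _,_; proj₁; proj₂)
open import Data.Sum using (_⊎_; inj₁; inj₂; [_,_]′)
open import Data.Unit using (⊤; tt)
open import Data.Empty using (⊥; ⊥-elim)
open import Function using (_∘_; _⇔_; mk⇔)
open import Level using (0ℓ)
open import Relation.Binary using (DecidableEquality; Symmetric)
open import Relation.Binary.PropositionalEquality
open import Relation.Nullary
open import Relation.Unary using (Pred; Decidable)

-- Numeric form of the separation bound, and its induction step in low dimension.

-- Two separated sides of sizes `a` and `b` among `N` vertices leave a cut of `N - (a + b)`. The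
-- bound `g k` on that cut is written additively, which avoids truncated subtraction and keeps the
-- condition decidable.
Sat : ℕ → (ℕ → ℕ) → ℕ → ℕ → Set
Sat N g a b = ∀ {k} → k < 5 → k ≤ a → k ≤ b → g k + (a + b) ≤ N

Sat-swap : ∀ {N g a b} → Sat N g a b → Sat N g b a
Sat-swap {N} {g} {a} {b} s {k} k<5 k≤b k≤a = subst (λ x → g k + x ≤ N) (+-comm a b) (s k<5 k≤a k≤b)

Sat? : ∀ N g a b → Dec (Sat N g a b)
Sat? N g a b = allUpTo? (λ k → k ≤? a →-dec k ≤? b →-dec g k + (a + b) ≤? N) 5

-- The bound 2nk − c for a cut with k vertices on both sides, c = 0, 3, 7, 12, is written at
-- n = 3 + t as offset k + 2kt.  For n ≤ 1 the value exceeds 3ⁿ: nothing is separable.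
offset : ℕ → ℕ
offset 0 = 0
offset 1 = 6
offset 2 = 9
offset 3 = 11
offset _ = 12

bound : ℕ → ℕ → ℕ
bound (suc (suc (suc t))) k = offset k + 2 * k * t
bound _ 0 = 0
bound 0 _ = 2
bound 1 _ = 4
bound 2 1 = 4
bound 2 _ = 5

-- Each hypothesis stands directly after the variables it mentions, so that the exhaustive search
-- deciding this statement prunes early.
SmallStep : ℕ → ℕ → Set
SmallStep n N =
  ∀ {a₀} → a₀ < suc N → ∀ {b₀} → b₀ < suc N → Sat N (bound n) a₀ b₀ →
  ∀ {a₁} → a₁ < suc N → a₁ + b₀ ≤ N → ∀ {b₁} → b₁ < suc N → a₀ + b₁ ≤ N → Sat N (bound n) a₁ b₁ →
  ∀ {a₂} → a₂ < suc N → a₂ + b₀ ≤ N → a₂ + b₁ ≤ N →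
  ∀ {b₂} → b₂ < suc N → a₀ + b₂ ≤ N → a₁ + b₂ ≤ N → Sat N (bound n) a₂ b₂ →
  Sat (3 * N) (bound (suc n)) (a₀ + a₁ + a₂) (b₀ + b₁ + b₂)

SmallStep? : ∀ n N → Dec (SmallStep n N)
SmallStep? n N =
  allUpTo? (λ a₀ → allUpTo? (λ b₀ → Sat? N (bound n) a₀ b₀ →-dec
  allUpTo? (λ a₁ → a₁ + b₀ ≤? N →-dec allUpTo? (λ b₁ → a₀ + b₁ ≤? N →-dec Sat? N (bound n) a₁ b₁ →-dec
  allUpTo? (λ a₂ → a₂ + b₀ ≤? N →-dec a₂ + b₁ ≤? N →-dec
  allUpTo? (λ b₂ → a₀ + b₂ ≤? N →-dec a₁ + b₂ ≤? N →-dec Sat? N (bound n) a₂ b₂ →-dec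
  Sat? (3 * N) (bound (suc n)) (a₀ + a₁ + a₂) (b₀ + b₁ + b₂))
  (suc N)) (suc N)) (suc N)) (suc N)) (suc N)) (suc N)

smallStep₀ : SmallStep 0 1
smallStep₀ = from-yes (SmallStep? 0 1)

smallStep₁ : SmallStep 1 3
smallStep₁ = from-yes (SmallStep? 1 3)

smallStep₂ : SmallStep 2 9
smallStep₂ = from-yes (SmallStep? 2 9)

-- The induction step from n = 3 + t

∑ : (Fin 3 → ℕ) → ℕ
∑ x = x zero + x (suc zero) + x (suc (suc zero))

term≤∑ : ∀ x i → x i ≤ ∑ x
term≤∑ x zero = ≤-trans (m≤m+n (x zero) (x (suc zero))) (m≤m+n _ _)
term≤∑ x (suc zero) = ≤-trans (m≤n+m (x (suc zero)) (x zero)) (m≤m+n _ _)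
term≤∑ x (suc (suc zero)) = m≤n+m _ _

-- In layer i, a i and b i count the vertices on the two sides and f i those of the cut.
record Layers (t N : ℕ) (a b f : Fin 3 → ℕ) : Set where
  field
    large : 27 + 8 * t ≤ N
    total : ∀ i → a i + b i + f i ≡ N
    cross : ∀ i j → a i + b j ≤ N
    inner : ∀ i → Sat N (bound (3 + t)) (a i) (b i)

  -- Seen geometrically, the copy in layer `j` of a vertex of the side `a` cannot lie on the side
  -- `b`, so it is in `a` or in the cut. Numerically this is `cross` combined with `total`.
  outer≤f : ∀ i j → a i ≤ a j + f j
  outer≤f i j = +-cancelʳ-≤ (b j) _ _ (begin
    a i + b j       ≤⟨ cross i j ⟩
    N               ≡⟨ total j ⟨
    a j + b j + f j ≡⟨ shuffle (a j) (b j) (f j) ⟩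
    a j + f j + b j ∎)
    where
    open ≤-Reasoning
    shuffle : ∀ x y z → x + y + z ≡ x + z + y
    shuffle = solve-∀

  bound≤f : ∀ i {k} → k < 5 → k ≤ a i → k ≤ b i → offset k + 2 * k * t ≤ f i
  bound≤f i {k} k<5 k≤a k≤b = +-cancelˡ-≤ (a i + b i) _ _ (begin
    a i + b i + (offset k + 2 * k * t) ≡⟨ +-comm (a i + b i) _ ⟩
    offset k + 2 * k * t + (a i + b i) ≤⟨ inner i k<5 k≤a k≤b ⟩
    N                                  ≡⟨ total i ⟨
    a i + b i + f i                    ∎)
    where open ≤-Reasoning

  N≤ : ∀ i → N ≤ ∑ f + (a i + b i)
  N≤ i = begin
    N                 ≡⟨ total i ⟨
    a i + b i + f i   ≡⟨ +-comm (a i + b i) (f i) ⟩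
    f i + (a i + b i) ≤⟨ +-monoˡ-≤ _ (term≤∑ f i) ⟩
    ∑ f + (a i + b i) ∎
    where open ≤-Reasoning

swap : ∀ {t N a b f} → Layers t N a b f → Layers t N b a f
swap {t} {N} {a} {b} {f} L = record
  { large = large
  ; total = λ i → trans (cong (_+ f i) (+-comm (b i) (a i))) (total i)
  ; cross = λ i j → subst (_≤ N) (+-comm (a j) (b i)) (cross j i)
  ; inner = λ i → Sat-swap {N} {bound (3 + t)} (inner i)
  }
  where open Layers L

-- Among the targets in dimension `4 + t`, the one for `k = 4` is the largest: its constant part is
-- 12 + 8.
small-cut-cap : ∀ {k m} t → k < 5 → m < offset k + 2 * k * suc t → m < 20 + 8 * t
small-cut-cap {k} {m} t k<5 m< = begin-strict
  m                              <⟨ m< ⟩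
  offset k + 2 * k * suc t       ≡⟨ shuffle (offset k) k t ⟩
  offset k + 2 * k + 2 * k * t   ≤⟨ +-mono-≤ (check k<5) (*-monoˡ-≤ t (*-monoʳ-≤ 2 (s≤s⁻¹ k<5))) ⟩
  20 + 8 * t                     ∎
  where
  open ≤-Reasoning
  shuffle : ∀ o k t → o + 2 * k * suc t ≡ o + 2 * k + 2 * k * t
  shuffle = solve-∀
  check : ∀ {k} → k < 5 → offset k + 2 * k ≤ 20
  check = from-yes (allUpTo? (λ k → offset k + 2 * k ≤? 20) 5)

-- A layer is too big to be exhausted by so small a cut and two sets of at most 3 vertices: together
-- these stay below `26 + 8 * t`.
not-both-small : ∀ {t N m x y} → 27 + 8 * t ≤ N → m < 20 + 8 * t →
  N ≤ m + (x + y) → x < 4 → y < 4 → ⊥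
not-both-small {t} {N} {m} {x} {y} large m< N≤ (s≤s x≤3) (s≤s y≤3) = <-irrefl refl (begin-strict
  N                     ≤⟨ N≤ ⟩
  m + (x + y)           <⟨ +-mono-<-≤ m< (+-mono-≤ x≤3 y≤3) ⟩
  20 + 8 * t + 6        ≡⟨ +-comm (20 + 8 * t) 6 ⟩
  26 + 8 * t            ≤⟨ n≤1+n _ ⟩
  27 + 8 * t            ≤⟨ large ⟩
  N                     ∎)
  where open ≤-Reasoning

-- Lower bound, without its part linear in t, for the cut of a layer holding x vertices of the
-- small side when the largest layer holds m: a layer with x = 0 still has a cut vertex next to
-- each of the m vertices.
share : ℕ → ℕ → ℕ
share m 0 = m
share m x = offset x

-- The left side is the constant part of the target one dimension up. The check is tight: layers
-- with 3, 1, 0 vertices give 11 + 6 + 3 = 20 for `k = 4`, so the share of the empty layer is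
-- indispensable.
shares : ∀ {k} → k < 5 → ∀ {x} → x < 4 → ∀ {y} → y < 4 → ∀ {z} → z < 4 → k ≤ x + y + z →
  offset k + 2 * k ≤ share (x ⊔ y ⊔ z) x + share (x ⊔ y ⊔ z) y + share (x ⊔ y ⊔ z) z
shares = from-yes (allUpTo? (λ k → allUpTo? (λ x → allUpTo? (λ y → allUpTo? (λ z →
  k ≤? x + y + z →-dec
  offset k + 2 * k ≤? share (x ⊔ y ⊔ z) x + share (x ⊔ y ⊔ z) y + share (x ⊔ y ⊔ z) z) 4) 4) 4) 5)

module _ {t N a b f} (L : Layers t N a b f) {k} (k<5 : k < 5) (k≤a : k ≤ ∑ a) (k≤b : k ≤ ∑ b) where
  open Layers L

  private
    k≤4 = s≤s⁻¹ k<5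

  -- If the cut were smaller, `not-both-small` would give `a i ≤ b i` in every layer. The inductive
  -- bound then applies in layer `i` with `a i` itself in place of `k`, an empty layer pays through
  -- `outer≤f`, and `shares` adds up the constants.
  all-light : (∀ i → a i < k) → offset k + 2 * k * suc t ≤ ∑ f
  all-light a<k = ≮⇒≥ λ f< →
    let m = a zero ⊔ a (suc zero) ⊔ a (suc (suc zero))
        a<4 : ∀ i → a i < 4
        a<4 i = <-≤-trans (a<k i) k≤4
        a≤b : ∀ i → a i ≤ b i
        a≤b i = ≮⇒≥ λ b<a →
          not-both-small {t} large (small-cut-cap t k<5 f<) (N≤ i) (a<4 i) (<-trans b<a (a<4 i))
        empty : ∀ i → a i ≡ 0 → m ≤ f i
        empty i ai≡0 = ⊔-lub (⊔-lub (le i ai≡0 _) (le i ai≡0 _)) (le i ai≡0 _)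
        layer : ∀ i → share m (a i) + 2 * a i * t ≤ f i
        layer i = layer′ m i (empty i) (bound≤f i (<-trans (a<4 i) (n<1+n 4)) ≤-refl (a≤b i))
    in <-irrefl refl (begin-strict
      ∑ f                                              <⟨ f< ⟩
      offset k + 2 * k * suc t                         ≡⟨ shuffle (offset k) k t ⟩
      offset k + 2 * k + 2 * k * t                     ≤⟨ +-mono-≤ (shares k<5 (a<4 _) (a<4 _) (a<4 _) k≤a)
                                                             (*-monoˡ-≤ t (*-monoʳ-≤ 2 k≤a)) ⟩
      ∑ (λ i → share m (a i)) + 2 * ∑ a * t            ≡⟨ regroup (share m (a zero)) (share m (a (suc zero)))
                                                             (share m (a (suc (suc zero)))) (a zero) (a (suc zero))
                                                             (a (suc (suc zero))) t ⟩
      ∑ (λ i → share m (a i) + 2 * a i * t)            ≤⟨ +-mono-≤ (+-mono-≤ (layer _) (layer _)) (layer _) ⟩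
      ∑ f                                              ∎)
    where
    open ≤-Reasoning
    shuffle : ∀ o k t → o + 2 * k * suc t ≡ o + 2 * k + 2 * k * t
    shuffle = solve-∀
    regroup : ∀ p q r x y z t → p + q + r + 2 * (x + y + z) * t ≡
      (p + 2 * x * t) + (q + 2 * y * t) + (r + 2 * z * t)
    regroup = solve-∀
    le : ∀ i → a i ≡ 0 → ∀ j → a j ≤ f i
    le i ai≡0 j = subst (λ x → a j ≤ x + f i) ai≡0 (outer≤f j i)
    layer′ : ∀ m i → (a i ≡ 0 → m ≤ f i) → offset (a i) + 2 * a i * t ≤ f i →
      share m (a i) + 2 * a i * t ≤ f i
    layer′ m i e h with a i
    ... | zero = subst (_≤ f i) (sym (+-identityʳ m)) (e refl)
    ... | suc _ = h

  -- As layer `l` has no vertex of the side `a`, every `a i` is at most `f l`. If layer `j` has none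
  -- either, then `k ≤ a i ≤ f l < k`. Otherwise both sides meet layer `j`, so `f j` is at least 6;
  -- since `f j + f l ≤ 7`, this leaves `f l ≤ 1`, hence `k ≤ 2` and `f j + f l < 4`.
  not-one-heavy : ∀ {i j l} → k ≤ a i + a j + a l → f j + f l < 2 * k → f l < k → a l ≡ 0 → ⊥
  not-one-heavy {i} {j} {l} k≤ fjl fl al≡0 with a j ≟ 0
  ... | yes aj≡0 = <-irrefl refl (begin-strict
    f l             <⟨ fl ⟩
    k               ≤⟨ k≤ ⟩
    a i + a j + a l ≡⟨ cong₂ (λ x y → a i + x + y) aj≡0 al≡0 ⟩
    a i + 0 + 0     ≡⟨ trans (+-identityʳ _) (+-identityʳ _) ⟩
    a i             ≤⟨ outer≤f i l ⟩
    a l + f l       ≡⟨ cong (_+ f l) al≡0 ⟩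
    f l             ∎)
    where open ≤-Reasoning
  ... | no aj≢0 = <-irrefl refl (begin-strict
    6               ≤⟨ 6≤fj ⟩
    f j             ≤⟨ m≤m+n _ _ ⟩
    f j + f l       <⟨ fjl ⟩
    2 * k           ≤⟨ *-monoʳ-≤ 2 k≤2 ⟩
    4               ≤⟨ m≤m+n 4 2 ⟩
    6               ∎)
    where
    open ≤-Reasoning
    a≤fl : ∀ i → a i ≤ f l
    a≤fl i = subst (λ x → a i ≤ x + f l) al≡0 (outer≤f i l)
    fjl≤7 : f j + f l ≤ 7
    fjl≤7 = s≤s⁻¹ (≤-trans fjl (*-monoʳ-≤ 2 k≤4))
    bj≢0 : b j ≢ 0
    bj≢0 bj≡0 = <-irrefl refl (begin-strict
      N                ≡⟨ total j ⟨
      a j + b j + f j  ≡⟨ cong (λ x → a j + x + f j) bj≡0 ⟩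
      a j + 0 + f j    ≤⟨ +-mono-≤ (+-monoˡ-≤ 0 (≤-trans (a≤fl j) (≤-trans (m≤n+m _ _) fjl≤7)))
                            (≤-trans (m≤m+n _ _) fjl≤7) ⟩
      14               ≤⟨ m≤m+n 14 12 ⟩
      26               <⟨ m≤m+n 27 (8 * t) ⟩
      27 + 8 * t       ≤⟨ large ⟩
      N                ∎)
    6≤fj : 6 ≤ f j
    6≤fj = ≤-trans (m≤m+n 6 _) (bound≤f j (s≤s (s≤s z≤n)) (n≢0⇒n>0 aj≢0) (n≢0⇒n>0 bj≢0))
    fl≤1 : f l ≤ 1
    fl≤1 = +-cancelˡ-≤ 6 _ _ (≤-trans (+-monoˡ-≤ (f l) 6≤fj) fjl≤7)
    k≤2 : k ≤ 2
    k≤2 = begin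
      k               ≤⟨ k≤ ⟩
      a i + a j + a l ≡⟨ cong (a i + a j +_) al≡0 ⟩
      a i + a j + 0   ≤⟨ +-monoˡ-≤ 0 (+-mono-≤ (≤-trans (a≤fl i) fl≤1) (≤-trans (a≤fl j) fl≤1)) ⟩
      2               ∎

-- Quantifying over all `x` forces `i`, `j`, `l` to be the three layers in some order; this form is
-- ready for rewriting sums.
Arrangement : Fin 3 → Fin 3 → Fin 3 → Set
Arrangement i j l = ∀ x → ∑ x ≡ x i + x j + x l

arr₀ : Arrangement zero (suc zero) (suc (suc zero))
arr₀ x = refl

arr₁ : Arrangement (suc zero) zero (suc (suc zero))
arr₁ x = cong (_+ x (suc (suc zero))) (+-comm (x zero) (x (suc zero)))

arr₂ : Arrangement (suc (suc zero)) zero (suc zero)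
arr₂ x = trans (+-comm (x zero + x (suc zero)) (x (suc (suc zero)))) (sym (+-assoc (x (suc (suc zero))) _ _))

arr-swap : ∀ {i j l} → Arrangement i j l → Arrangement i l j
arr-swap {i} {j} {l} arr x = trans (arr x) (shuffle (x i) (x j) (x l))
  where
  shuffle : ∀ p q r → p + q + r ≡ p + r + q
  shuffle = solve-∀

module _ {t N a b f} (L : Layers t N a b f) {k} (k<5 : k < 5) (k≤a : k ≤ ∑ a) (k≤b : k ≤ ∑ b)
         (f< : ∑ f < offset k + 2 * k * suc t) where
  open Layers L

  private
    k≤4 = s≤s⁻¹ k<5

  -- The target grows by only `2 * k` per dimension, so the other two layers share fewer than
  -- `2 * k` cut vertices and the poorer one, `l`, has fewer than `k ≤ 4`. Meeting both sides would
  -- cost it at least 6, so one side misses it.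
  no-heavy-sorted : ∀ {i j l} → Arrangement i j l → f l ≤ f j → ¬ (offset k + 2 * k * t ≤ f i)
  no-heavy-sorted {i} {j} {l} arr fl≤fj heavy = side (a l ≟ 0) (b l ≟ 0)
    where
    open ≤-Reasoning
    shuffle : ∀ o k t → o + 2 * k * suc t ≡ o + 2 * k * t + 2 * k
    shuffle = solve-∀
    fjl : f j + f l < 2 * k
    fjl = +-cancelˡ-< (offset k + 2 * k * t) _ _ (begin-strict
      offset k + 2 * k * t + (f j + f l) ≤⟨ +-monoˡ-≤ _ heavy ⟩
      f i + (f j + f l)                  ≡⟨ +-assoc (f i) (f j) (f l) ⟨
      f i + f j + f l                    ≡⟨ arr f ⟨
      ∑ f                                <⟨ f< ⟩
      offset k + 2 * k * suc t           ≡⟨ shuffle (offset k) k t ⟩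
      offset k + 2 * k * t + 2 * k       ∎)
    fl : f l < k
    fl = *-cancelˡ-< 2 _ _ (begin-strict
      2 * f l   ≡⟨ cong (f l +_) (+-identityʳ (f l)) ⟩
      f l + f l ≤⟨ +-monoˡ-≤ (f l) fl≤fj ⟩
      f j + f l <⟨ fjl ⟩
      2 * k     ∎)
    side : Dec (a l ≡ 0) → Dec (b l ≡ 0) → ⊥
    side (yes al≡0) _ = not-one-heavy L k<5 k≤a k≤b {i} {j} (subst (k ≤_) (arr a) k≤a) fjl fl al≡0
    side _ (yes bl≡0) = not-one-heavy (swap L) k<5 k≤b k≤a {i} {j} (subst (k ≤_) (arr b) k≤b) fjl fl bl≡0
    side (no al≢0) (no bl≢0) = <⇒≱ (<-≤-trans fl k≤4) (begin
      4           ≤⟨ m≤m+n 4 2 ⟩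
      6           ≤⟨ m≤m+n 6 _ ⟩
      6 + 2 * t   ≤⟨ bound≤f l (s≤s (s≤s z≤n)) (n≢0⇒n>0 al≢0) (n≢0⇒n>0 bl≢0) ⟩
      f l         ∎)

  no-heavy : ∀ {i j l} → Arrangement i j l → ¬ (offset k + 2 * k * t ≤ f i)
  no-heavy {i} {j} {l} arr with ≤-total (f l) (f j)
  ... | inj₁ fl≤fj = no-heavy-sorted arr fl≤fj
  ... | inj₂ fj≤fl = no-heavy-sorted (arr-swap {i} {j} {l} arr) fj≤fl

  -- With `k` vertices on both sides, the inductive bound would make layer `i` heavy.
  light : ∀ {i j l} → Arrangement i j l → a i < k ⊎ b i < k
  light {i} arr with k ≤? a i | k ≤? b i
  ... | no a≱k | _      = inj₁ (≰⇒> a≱k)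
  ... | _      | no b≱k = inj₂ (≰⇒> b≱k)
  ... | yes k≤ai | yes k≤bi = ⊥-elim (no-heavy arr (bound≤f i k<5 k≤ai k≤bi))

  -- Add the totals of layers `i` and `j` and remove `a j + b i ≤ N`: what is left shows that the
  -- cut together with `a i + b j ≤ 6` accounts for a whole layer.
  not-opposite : ∀ {i j l} → Arrangement i j l → a i < k → b j < k → ⊥
  not-opposite {i} {j} {l} arr ai<k bj<k =
    not-both-small {t} large (small-cut-cap t k<5 f<) N≤′ (<-≤-trans ai<k k≤4) (<-≤-trans bj<k k≤4)
    where
    open ≤-Reasoning
    shuffle : ∀ x y z u v w → (x + y + z) + (u + v + w) ≡ z + w + (x + v) + (u + y)
    shuffle = solve-∀
    N≤′ : N ≤ ∑ f + (a i + b j)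
    N≤′ = +-cancelʳ-≤ N _ _ (begin
      N + N                                   ≡⟨ cong₂ _+_ (total i) (total j) ⟨
      (a i + b i + f i) + (a j + b j + f j)   ≡⟨ shuffle (a i) (b i) (f i) (a j) (b j) (f j) ⟩
      f i + f j + (a i + b j) + (a j + b i)   ≤⟨ +-mono-≤ (+-monoˡ-≤ (a i + b j) (m≤m+n (f i + f j) (f l))) (cross j i) ⟩
      f i + f j + f l + (a i + b j) + N       ≡⟨ cong (λ s → s + (a i + b j) + N) (arr f) ⟨
      ∑ f + (a i + b j) + N                   ∎)

-- If the cut were too small, every layer would be light on some side, by `not-opposite` on the same
-- side in all three layers, and `all-light` would contradict the assumption.
large-step : ∀ {t N a b f} → Layers t N a b f → Sat (3 * N) (bound (4 + t)) (∑ a) (∑ b)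
large-step {t} {N} {a} {b} {f} L {k} k<5 k≤a k≤b = begin
  offset k + 2 * k * suc t + (∑ a + ∑ b) ≤⟨ +-monoˡ-≤ _ (≮⇒≥ absurd) ⟩
  ∑ f + (∑ a + ∑ b)                      ≡⟨ shuffle (a zero) (a (suc zero)) _ (b zero) (b (suc zero)) _ (f zero) (f (suc zero)) _ ⟩
  ∑ (λ i → a i + b i + f i)              ≡⟨ cong₂ _+_ (cong₂ _+_ (total zero) (total (suc zero))) (total (suc (suc zero))) ⟩
  N + N + N                              ≡⟨ triple N ⟩
  3 * N                                  ∎
  where
  open ≤-Reasoning
  open Layers L
  triple : ∀ n → n + n + n ≡ 3 * n
  triple = solve-∀
  shuffle : ∀ a b c d e f g h i → (g + h + i) + ((a + b + c) + (d + e + f)) ≡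
    (a + d + g) + (b + e + h) + (c + f + i)
  shuffle = solve-∀
  absurd : ¬ (∑ f < offset k + 2 * k * suc t)
  absurd f< = sides (li arr₀) (li arr₁) (li arr₂)
    where
    li : ∀ {i j l} → Arrangement i j l → a i < k ⊎ b i < k
    li = light L k<5 k≤a k≤b f<
    opp : ∀ {i j l} → Arrangement i j l → a i < k → b j < k → ⊥
    opp = not-opposite L k<5 k≤a k≤b f<
    sides : a zero < k ⊎ b zero < k → a (suc zero) < k ⊎ b (suc zero) < k →
            a (suc (suc zero)) < k ⊎ b (suc (suc zero)) < k → ⊥
    sides (inj₁ p) (inj₁ q) (inj₁ r) = <⇒≱ f< (all-light L k<5 k≤a k≤b λ { zero → p ; (suc zero) → q ; (suc (suc zero)) → r })
    sides (inj₂ p) (inj₂ q) (inj₂ r) = <⇒≱ f< (all-light (swap L) k<5 k≤b k≤a λ { zero → p ; (suc zero) → q ; (suc (suc zero)) → r })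
    sides (inj₁ p) (inj₂ q) _ = opp arr₀ p q
    sides (inj₂ p) (inj₁ q) _ = opp arr₁ q p
    sides (inj₁ p) (inj₁ q) (inj₂ r) = opp (arr-swap {zero} {suc zero} {suc (suc zero)} arr₀) p r
    sides (inj₂ p) (inj₂ q) (inj₁ r) = opp arr₂ r p

-- Counting vertices of the cube

module _ {A : Set} where

  count-disjoint : {P Q : Pred A 0ℓ} (P? : Decidable P) (Q? : Decidable Q) →
    (∀ {x} → P x → ¬ Q x) → ∀ xs → length (filter P? xs) + length (filter Q? xs) ≤ length xs
  count-disjoint P? Q? disj [] = z≤n
  count-disjoint P? Q? disj (x ∷ xs) with P? x | Q? x | count-disjoint P? Q? disj xs
  ... | yes p | yes q | _  = contradiction q (disj p)
  ... | yes _ | no _  | ih = s≤s ih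
  ... | no _  | yes _ | ih = subst (_≤ suc (length xs)) (sym (+-suc _ _)) (s≤s ih)
  ... | no _  | no _  | ih = m≤n⇒m≤1+n ih

  count-∪ : {P Q R : Pred A 0ℓ} (P? : Decidable P) (Q? : Decidable Q) (R? : Decidable R) →
    (∀ {x} → P x → Q x ⊎ R x) → ∀ xs →
    length (filter P? xs) ≤ length (filter Q? xs) + length (filter R? xs)
  count-∪ P? Q? R? cov [] = z≤n
  count-∪ P? Q? R? cov (x ∷ xs) with P? x | Q? x | R? x | count-∪ P? Q? R? cov xs
  ... | yes p | no ¬q | no ¬r | _  = ⊥-elim ([ ¬q , ¬r ]′ (cov p))
  ... | yes _ | yes _ | no _  | ih = s≤s ih
  ... | yes _ | yes _ | yes _ | ih = s≤s (≤-trans ih (+-monoʳ-≤ (length (filter Q? xs)) (n≤1+n _)))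
  ... | yes _ | no _  | yes _ | ih = ≤-trans (s≤s ih) (≤-reflexive (sym (+-suc _ _)))
  ... | no _  | yes _ | yes _ | ih = m≤n⇒m≤1+n (≤-trans ih (+-monoʳ-≤ _ (n≤1+n _)))
  ... | no _  | yes _ | no _  | ih = m≤n⇒m≤1+n ih
  ... | no _  | no _  | yes _ | ih = ≤-trans ih (+-monoʳ-≤ _ (n≤1+n _))
  ... | no _  | no _  | no _  | ih = ih

  module _ (_≟ᴬ_ : DecidableEquality A) where
    open DecMembership _≟ᴬ_ using (_∈?_)

    count-≡ : ∀ y {xs} → Unique xs → length (filter (_≟ᴬ y) xs) ≤ 1
    count-≡ y [] = z≤n
    count-≡ y {x ∷ xs} (x∉xs ∷ u) with x ≟ᴬ y
    ... | yes refl = s≤s (≤-reflexive (cong length (filter-none (_≟ᴬ y) (All.map (_∘ sym) x∉xs))))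
    ... | no _     = count-≡ y u

    count-∈ : ∀ {xs} → Unique xs → ∀ ys → length (filter (_∈? ys) xs) ≤ length ys
    count-∈ {xs} u [] = ≤-reflexive (cong length (filter-none (_∈? []) (All.universal (λ _ ()) xs)))
    count-∈ {xs} u (y ∷ ys) = ≤-trans
      (count-∪ (_∈? (y ∷ ys)) (_≟ᴬ y) (_∈? ys) (λ { (here e) → inj₁ e ; (there p) → inj₂ p }) xs)
      (+-mono-≤ (count-≡ y u) (count-∈ u ys))

length-filter-map : {A B : Set} {P : Pred B 0ℓ} (P? : Decidable P) (f : A → B) → ∀ xs →
  length (filter P? (map f xs)) ≡ length (filter (P? ∘ f) xs)
length-filter-map P? f [] = refl
length-filter-map P? f (x ∷ xs) with P? (f x)
... | yes _ = cong suc (length-filter-map P? f xs)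
... | no _  = length-filter-map P? f xs

vertices : ∀ n → List (Vertex n)
vertices zero    = [] ∷ []
vertices (suc n) = cartesianProductWith _∷_ (allFin 3) (vertices n)

∈-vertices : ∀ {n} (v : Vertex n) → v ∈ vertices n
∈-vertices []      = here refl
∈-vertices (i ∷ v) = ∈-cartesianProductWith⁺ _∷_ (∈-allFin i) (∈-vertices v)

vertices-unique : ∀ n → Unique (vertices n)
vertices-unique zero    = [] ∷ []
vertices-unique (suc n) = cartesianProductWith⁺ _∷_ ∷-injective (allFin⁺ 3) (vertices-unique n)

size : ∀ {n} {P : Pred (Vertex n) 0ℓ} → Decidable P → ℕ
size {n} P? = length (filter P? (vertices n))

size-layers : ∀ {n} {P : Pred (Vertex (suc n)) 0ℓ} (P? : Decidable P) →
  size P? ≡ ∑ (λ i → size (P? ∘ (i ∷_)))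
size-layers {n} P? = begin
  size P?
    ≡⟨ split zero _ ⟩
  s zero + length (filter P? (l (suc zero) ++ (l (suc (suc zero)) ++ [])))
    ≡⟨ cong (s zero +_) (split (suc zero) _) ⟩
  s zero + (s (suc zero) + length (filter P? (l (suc (suc zero)) ++ [])))
    ≡⟨ cong (λ z → s zero + (s (suc zero) + z)) (trans (split (suc (suc zero)) []) (+-identityʳ _)) ⟩
  s zero + (s (suc zero) + s (suc (suc zero)))
    ≡⟨ +-assoc (s zero) _ _ ⟨
  ∑ s ∎
  where
  open ≡-Reasoning
  l : Fin 3 → List (Vertex (suc n))
  l i = map (i ∷_) (vertices n)
  s : Fin 3 → ℕ
  s i = size (P? ∘ (i ∷_))
  split : ∀ i ws → length (filter P? (l i ++ ws)) ≡ s i + length (filter P? ws)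
  split i ws = trans (cong length (filter-++ P? (l i) ws)) (trans (length-++ (filter P? (l i)))
    (cong (_+ length (filter P? ws)) (length-filter-map P? (i ∷_) (vertices n))))

length-vertices : ∀ n → length (vertices n) ≡ 3 ^ n
length-vertices zero    = refl
length-vertices (suc n) = begin
  length (vertices (suc n))      ≡⟨ all (vertices (suc n)) ⟨
  size {suc n} always            ≡⟨ size-layers {n} always ⟩
  ∑ (λ _ → size {n} always)      ≡⟨ cong (λ m → m + m + m) (trans (all (vertices n)) (length-vertices n)) ⟩
  3 ^ n + 3 ^ n + 3 ^ n          ≡⟨ triple (3 ^ n) ⟩
  3 * 3 ^ n                      ∎
  where
  open ≡-Reasoning
  always : {A : Set} → Decidable {A = A} (λ _ → ⊤)
  always _ = yes tt
  all : {A : Set} (xs : List A) → length (filter always xs) ≡ length xs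
  all xs = cong length (filter-all always (All.universal (λ _ → tt) xs))
  triple : ∀ n → n + n + n ≡ 3 * n
  triple = solve-∀

-- Separated vertex sets and the induction over layers.

Adj-∷ : ∀ {n} i {u v : Vertex n} → Adj u v → Adj (i ∷ u) (i ∷ v)
Adj-∷ i {u} {v} (j , d , same) = suc j , d , same′
  where
  same′ : ∀ k → k ≢ suc j → lookup (i ∷ u) k ≡ lookup (i ∷ v) k
  same′ zero    _   = refl
  same′ (suc k) k≢j = same k (k≢j ∘ cong suc)

-- Distinct residues modulo 3 always differ by 1 or -1: each column is a triangle.
Adj-column : ∀ {n i j} (v : Vertex n) → i ≢ j → Adj (i ∷ v) (j ∷ v)
Adj-column {i = i} {j} v i≢j = zero , differ i j i≢j , same
  where
  same : ∀ k → k ≢ zero → lookup (i ∷ v) k ≡ lookup (j ∷ v) k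
  same zero    k≢0 = contradiction refl k≢0
  same (suc k) _   = refl
  differ : ∀ i j → i ≢ j → i ≡ suc3 j ⊎ i ≡ pred3 j
  differ zero zero i≢j = contradiction refl i≢j
  differ zero (suc zero) _ = inj₂ refl
  differ zero (suc (suc zero)) _ = inj₁ refl
  differ (suc zero) zero _ = inj₁ refl
  differ (suc zero) (suc zero) i≢j = contradiction refl i≢j
  differ (suc zero) (suc (suc zero)) _ = inj₂ refl
  differ (suc (suc zero)) zero _ = inj₂ refl
  differ (suc (suc zero)) (suc zero) _ = inj₁ refl
  differ (suc (suc zero)) (suc (suc zero)) i≢j = contradiction refl i≢j

Apart : ∀ {n} → Pred (Vertex n) 0ℓ → Pred (Vertex n) 0ℓ → Set
Apart P Q = ∀ {u v} → P u → Q v → u ≢ v × ¬ Adj u v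

Apart-layer : ∀ {n} {P Q : Pred (Vertex (suc n)) 0ℓ} → Apart P Q → ∀ i → Apart (P ∘ (i ∷_)) (Q ∘ (i ∷_))
Apart-layer ap i p q = (λ e → proj₁ (ap p q) (cong (i ∷_) e)) , (λ e → proj₂ (ap p q) (Adj-∷ i e))

Apart-layers-disjoint : ∀ {n} {P Q : Pred (Vertex (suc n)) 0ℓ} → Apart P Q →
  ∀ i j {v} → P (i ∷ v) → ¬ Q (j ∷ v)
Apart-layers-disjoint ap i j {v} p q with i Fin.≟ j
... | yes refl = proj₁ (ap p q) refl
... | no i≢j   = proj₂ (ap p q) (Adj-column v i≢j)

27+8t≤3^ : ∀ t → 27 + 8 * t ≤ 3 ^ (3 + t)
27+8t≤3^ zero    = ≤-refl
27+8t≤3^ (suc t) = begin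
  27 + 8 * suc t                  ≤⟨ m≤m+n _ (46 + 16 * t) ⟩
  27 + 8 * suc t + (46 + 16 * t)  ≡⟨ eq t ⟩
  3 * (27 + 8 * t)                ≤⟨ *-monoʳ-≤ 3 (27+8t≤3^ t) ⟩
  3 ^ (4 + t)                     ∎
  where
  open ≤-Reasoning
  eq : ∀ t → 27 + 8 * suc t + (46 + 16 * t) ≡ 3 * (27 + 8 * t)
  eq = solve-∀

apart-sizes : ∀ n {P Q : Pred (Vertex n) 0ℓ} (P? : Decidable P) (Q? : Decidable Q) → Apart P Q →
  Sat (3 ^ n) (bound n) (size P?) (size Q?)
apart-sizes zero P? Q? ap {k} _ k≤a k≤b with P? [] | Q? []
... | yes p | yes q = contradiction refl (proj₁ (ap p q))
apart-sizes zero P? Q? ap {zero} _ k≤a k≤b | yes _ | no _ = ≤-refl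
apart-sizes zero P? Q? ap {zero} _ k≤a k≤b | no _ | yes _ = ≤-refl
apart-sizes zero P? Q? ap {zero} _ k≤a k≤b | no _ | no _ = z≤n
apart-sizes (suc n) P? Q? ap =
  subst₂ (Sat (3 ^ suc n) (bound (suc n))) (sym (size-layers P?)) (sym (size-layers Q?)) (sum n cross inner)
  where
  a b : Fin 3 → ℕ
  a i = size (P? ∘ (i ∷_))
  b i = size (Q? ∘ (i ∷_))
  cross : ∀ i j → a i + b j ≤ 3 ^ n
  cross i j = subst (a i + b j ≤_) (length-vertices n)
    (count-disjoint (P? ∘ (i ∷_)) (Q? ∘ (j ∷_)) (Apart-layers-disjoint ap i j) (vertices n))
  inner : ∀ i → Sat (3 ^ n) (bound n) (a i) (b i)
  inner i = apart-sizes n (P? ∘ (i ∷_)) (Q? ∘ (i ∷_)) (Apart-layer ap i)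
  small : ∀ m {N} → SmallStep m N → (∀ i j → a i + b j ≤ N) → (∀ i → Sat N (bound m) (a i) (b i)) →
    Sat (3 * N) (bound (suc m)) (∑ a) (∑ b)
  small m {N} s cr inn = s (a< zero) (b< zero) (inn zero)
    (a< (suc zero)) (cr _ _) (b< (suc zero)) (cr _ _) (inn (suc zero))
    (a< (suc (suc zero))) (cr _ _) (cr _ _) (b< (suc (suc zero))) (cr _ _) (cr _ _) (inn (suc (suc zero)))
    where
    a< : ∀ i → a i < suc N
    a< i = s≤s (≤-trans (m≤m+n (a i) (b zero)) (cr i zero))
    b< : ∀ i → b i < suc N
    b< i = s≤s (≤-trans (m≤n+m (b i) (a zero)) (cr zero i))
  sum : ∀ m → (∀ i j → a i + b j ≤ 3 ^ m) → (∀ i → Sat (3 ^ m) (bound m) (a i) (b i)) →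
    Sat (3 ^ suc m) (bound (suc m)) (∑ a) (∑ b)
  sum 0 = small 0 smallStep₀
  sum 1 = small 1 smallStep₁
  sum 2 = small 2 smallStep₂
  -- The cut enters only as a number per layer, namely what the two sides leave over; `cr i i`
  -- ensures that the subtraction does not truncate.
  sum (suc (suc (suc t))) cr inn = large-step {f = λ i → 3 ^ (3 + t) ∸ (a i + b i)} record
    { large = 27+8t≤3^ t
    ; total = λ i → m+[n∸m]≡n (cr i i)
    ; cross = cr
    ; inner = inn
    }

-- Components

_≟ⱽ_ : ∀ {n} → DecidableEquality (Vertex n)
_≟ⱽ_ = ≡-dec Fin._≟_

Adj? : ∀ {n} (u v : Vertex n) → Dec (Adj u v)
Adj? u v = any? λ j →
  (lookup u j Fin.≟ suc3 (lookup v j) ⊎-dec lookup u j Fin.≟ pred3 (lookup v j)) ×-dec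
  all? (λ i → ¬? (i Fin.≟ j) →-dec lookup u i Fin.≟ lookup v i)

Adj-sym : ∀ {n} {u v : Vertex n} → Adj u v → Adj v u
Adj-sym {u = u} {v} (j , d , same) = j , flip (lookup u j) (lookup v j) d , λ i i≢j → sym (same i i≢j)
  where
  flip : ∀ x y → x ≡ suc3 y ⊎ x ≡ pred3 y → y ≡ suc3 x ⊎ y ≡ pred3 x
  flip _ zero             (inj₁ refl) = inj₂ refl
  flip _ (suc zero)       (inj₁ refl) = inj₂ refl
  flip _ (suc (suc zero)) (inj₁ refl) = inj₂ refl
  flip _ zero             (inj₂ refl) = inj₁ refl
  flip _ (suc zero)       (inj₂ refl) = inj₁ refl
  flip _ (suc (suc zero)) (inj₂ refl) = inj₁ refl

AllPairs-lookup : {A : Set} {R : A → A → Set} → Symmetric R → ∀ {xs} → AllPairs R xs →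
  ∀ i j → i ≢ j → R (List.lookup xs i) (List.lookup xs j)
AllPairs-lookup s (_ ∷ _)  zero    zero    i≢j = contradiction refl i≢j
AllPairs-lookup s (r ∷ _)  zero    (suc j) _   = All.lookup r (∈-lookup j)
AllPairs-lookup s (r ∷ _)  (suc i) zero    _   = s (All.lookup r (∈-lookup i))
AllPairs-lookup s (_ ∷ rs) (suc i) (suc j) i≢j = AllPairs-lookup s rs i j (i≢j ∘ cong suc)

module Components {n} (F : List (Vertex n)) where

  open DecMembership (_≟ⱽ_ {n}) using (_∈?_; _∉?_)

  source-∉ : ∀ {u v} → Reach F u v → u ∉ F
  source-∉ (here u∉F)     = u∉F
  source-∉ (step u∉F _ _) = u∉F

  target-∉ : ∀ {u v} → Reach F u v → v ∉ F
  target-∉ (here v∉F)   = v∉F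
  target-∉ (step _ _ r) = target-∉ r

  Reach-trans : ∀ {u v w} → Reach F u v → Reach F v w → Reach F u w
  Reach-trans (here _)       r = r
  Reach-trans (step u∉F a s) r = step u∉F a (Reach-trans s r)

  Reach-edge : ∀ {u v} → u ∉ F → v ∉ F → Adj u v → Reach F u v
  Reach-edge u∉F v∉F a = step u∉F a (here v∉F)

  Reach-sym : ∀ {u v} → Reach F u v → Reach F v u
  Reach-sym (here u∉F)     = here u∉F
  Reach-sym (step {u} {w} u∉F a r) =
    Reach-trans (Reach-sym r) (Reach-edge (source-∉ r) u∉F (Adj-sym {u = u} {w} a))

  -- Warshall: Via ws u v is reachability by a walk whose inner vertices all lie in ws.
  Via : List (Vertex n) → Vertex n → Vertex n → Set
  Via []       u v = u ∉ F × v ∉ F × (u ≡ v ⊎ Adj u v)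
  Via (w ∷ ws) u v = Via ws u v ⊎ (Via ws u w × Via ws w v)

  Via? : ∀ ws u v → Dec (Via ws u v)
  Via? []       u v = u ∉? F ×-dec v ∉? F ×-dec (u ≟ⱽ v ⊎-dec Adj? u v)
  Via? (w ∷ ws) u v = Via? ws u v ⊎-dec (Via? ws u w ×-dec Via? ws w v)

  Via⇒Reach : ∀ ws {u v} → Via ws u v → Reach F u v
  Via⇒Reach [] (u∉F , _ , inj₁ refl)  = here u∉F
  Via⇒Reach [] (u∉F , v∉F , inj₂ a)   = Reach-edge u∉F v∉F a
  Via⇒Reach (w ∷ ws) (inj₁ p)         = Via⇒Reach ws p
  Via⇒Reach (w ∷ ws) (inj₂ (p , q))   = Reach-trans (Via⇒Reach ws p) (Via⇒Reach ws q)

  Via-direct : ∀ ws {u v} → Via [] u v → Via ws u v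
  Via-direct []       p = p
  Via-direct (w ∷ ws) p = inj₁ (Via-direct ws p)

  -- Loops at the head `x` are discarded: a walk through `x` is cut at its first and last visit, so
  -- that neither piece has `x` inside.
  Via-trans : ∀ ws {u w v} → w ∈ ws → Via ws u w → Via ws w v → Via ws u v
  Via-trans (x ∷ ws) (here refl) p q = inj₂ (into p , out q)
    where
    into : ∀ {u} → Via ws u x ⊎ (Via ws u x × Via ws x x) → Via ws u x
    into (inj₁ p)       = p
    into (inj₂ (p , _)) = p
    out : ∀ {v} → Via ws x v ⊎ (Via ws x x × Via ws x v) → Via ws x v
    out (inj₁ q)       = q
    out (inj₂ (_ , q)) = q
  Via-trans (x ∷ ws) (there w∈) (inj₁ p) (inj₁ q) = inj₁ (Via-trans ws w∈ p q)
  Via-trans (x ∷ ws) (there w∈) (inj₁ p) (inj₂ (q , q′)) = inj₂ (Via-trans ws w∈ p q , q′)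
  Via-trans (x ∷ ws) (there w∈) (inj₂ (p , p′)) (inj₁ q) = inj₂ (p , Via-trans ws w∈ p′ q)
  Via-trans (x ∷ ws) (there w∈) (inj₂ (p , p′)) (inj₂ (q , q′)) = inj₂ (p , q′)

  Reach⇒Via : ∀ {u v} → Reach F u v → Via (vertices n) u v
  Reach⇒Via (here u∉F) = Via-direct (vertices n) (u∉F , u∉F , inj₁ refl)
  Reach⇒Via (step {w = w} u∉F a r) =
    Via-trans (vertices n) (∈-vertices w) (Via-direct (vertices n) (u∉F , source-∉ r , inj₂ a)) (Reach⇒Via r)

  Reach? : ∀ u v → Dec (Reach F u v)
  Reach? u v = map′ (Via⇒Reach (vertices n)) Reach⇒Via (Via? (vertices n) u v)

  Rest : Pred (Vertex n) 0ℓ → Pred (Vertex n) 0ℓ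
  Rest P v = v ∉ F × ¬ P v

  Rest? : ∀ {P} → Decidable P → Decidable (Rest P)
  Rest? P? v = v ∉? F ×-dec ¬? (P? v)

  -- These are the unions of components of the graph without `F`.
  Closed : Pred (Vertex n) 0ℓ → Set
  Closed P = (∀ {u} → P u → u ∉ F) × (∀ {u v} → P u → Adj u v → v ∉ F → P v)

  Reach-closed : ∀ r → Closed (Reach F r)
  Reach-closed r = target-∉ , λ p a v∉F → Reach-trans p (Reach-edge (target-∉ p) v∉F a)

  Any-closed : ∀ rs → Closed (λ v → Any (λ r → Reach F r v) rs)
  Any-closed rs = (λ p → target-∉ (proj₂ (proj₂ (find p)))) ,
                  (λ p a v∉F → Any.map (λ q → proj₂ (Reach-closed _) q a v∉F) p)

  reps : ∀ rs → All (_∉ F) rs → AllPairs (λ u v → ¬ Reach F u v) rs →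
    (∀ v → v ∉ F → Any (λ r → Reach F r v) rs) → ComponentReps F (List.lookup rs)
  reps rs alive apart cover =
    (λ i → All.lookup alive (∈-lookup i)) ,
    AllPairs-lookup (λ ¬uv → ¬uv ∘ Reach-sym) apart ,
    (λ v v∉F → Any.index (cover v v∉F) , Any.lookup-index (cover v v∉F))

  -- Classification when at most three surviving vertices lie outside one component.

  module Minor {r} (r∉F : r ∉ F) where

    S : Pred (Vertex n) 0ℓ
    S = Rest (Reach F r)

    -- A walk starting in `S` never enters the component of `r`, since walking back would put its
    -- start there too. Hence an invariant need only survive edges that end in `S`.
    stays : {P : Pred (Vertex n) 0ℓ} → (∀ u w → P u → Adj u w → S w → P w) →
      ∀ {u v} → S u → P u → Reach F u v → P v
    stays next _ p (here _) = p
    stays next (_ , ¬ru) p (step {u} {w} u∉F a s) = stays next Sw (next u w p a Sw) s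
      where
      Sw : S w
      Sw = source-∉ s , λ rw → ¬ru (Reach-trans rw (Reach-edge (source-∉ s) u∉F (Adj-sym {u = u} {w} a)))

    isolated : ∀ {x} → S x → (∀ w → S w → Adj x w → w ≡ x) → CompIsK1 F x
    isolated {x} Sx next v = stays {_≡ x} (λ { _ w refl a Sw → next w Sw a }) Sx refl

    -- The representative `r` comes last because the four cases prescribe the shapes of the first
    -- components and leave the last one free.
    S-rep : ∀ xs → All S xs → AllPairs (λ u v → ¬ Reach F u v) xs →
      (∀ {v} → S v → Any (λ x → Reach F x v) xs) → ComponentReps F (List.lookup (xs List.∷ʳ r))
    S-rep xs Sxs apart cover = reps (xs List.∷ʳ r) (All.∷ʳ⁺ (All.map proj₁ Sxs) r∉F)
      (AllPairs.++⁺ apart ([] ∷ []) (All.map (λ (_ , ¬rx) → ¬rx ∘ Reach-sym ∷ []) Sxs)) cover′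
      where
      cover′ : ∀ v → v ∉ F → Any (λ u → Reach F u v) (xs List.∷ʳ r)
      cover′ v v∉F with Reach? r v
      ... | yes rv = Any.++⁺ʳ xs (here rv)
      ... | no ¬rv = Any.++⁺ˡ (cover (v∉F , ¬rv))

    Outcome : Set
    Outcome = Case1 F ⊎ Case2 F ⊎ Case3 F ⊎ Case4 F

    one : ∀ {x} → S x → (∀ {v} → S v → v ≡ x) → Outcome
    one {x} Sx only = inj₁ (_ , S-rep (x ∷ []) (Sx ∷ []) ([] ∷ []) (λ Sv → here (to Sv)) ,
      inj₁ (isolated Sx λ w Sw _ → only Sw))
      where
      to : ∀ {v} → S v → Reach F x v
      to Sv with refl ← only Sv = here (proj₁ Sx)

    two : ∀ {x y} → S x → S y → x ≢ y → (∀ {v} → S v → v ≡ x ⊎ v ≡ y) → Outcome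
    two {x} {y} Sx@(x∉F , _) Sy@(y∉F , _) x≢y only with Adj? x y
    ... | yes a = inj₁ (_ , S-rep (x ∷ []) (Sx ∷ []) ([] ∷ []) (λ Sv → here (to (only Sv))) ,
      inj₂ (inj₁ (x , y , x≢y , a , λ v → mk⇔ (stays (λ _ _ _ _ Sw → only Sw) Sx (inj₁ refl)) to)))
      where
      to : ∀ {v} → v ≡ x ⊎ v ≡ y → Reach F x v
      to (inj₁ refl) = here x∉F
      to (inj₂ refl) = Reach-edge x∉F y∉F a
    ... | no ¬a = inj₂ (inj₁ (_ , S-rep (x ∷ y ∷ []) (Sx ∷ Sy ∷ [])
      (((λ xy → x≢y (sym (Kx y xy))) ∷ []) ∷ [] ∷ []) (λ Sv → cover (only Sv)) , Kx , Ky))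
      where
      Kx : CompIsK1 F x
      Kx = isolated Sx λ w Sw a → [ (λ e → e) , (λ { refl → contradiction a ¬a }) ]′ (only Sw)
      Ky : CompIsK1 F y
      Ky = isolated Sy λ w Sw a → [ (λ { refl → contradiction (Adj-sym {u = y} {x} a) ¬a }) , (λ e → e) ]′ (only Sw)
      cover : ∀ {v} → v ≡ x ⊎ v ≡ y → Any (λ u → Reach F u v) (x ∷ y ∷ [])
      cover (inj₁ refl) = here (here x∉F)
      cover (inj₂ refl) = there (here (here y∉F))

    record Triple (x y z : Vertex n) : Set where
      field
        Sx : S x
        Sy : S y
        Sz : S z
        x≢y : x ≢ y
        y≢z : y ≢ z
        x≢z : x ≢ z
        only : ∀ {v} → S v → v ≡ x ⊎ v ≡ y ⊎ v ≡ z

    swap₁₂ : ∀ {x y z} → Triple x y z → Triple y x z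
    swap₁₂ T = record { Sx = Sy ; Sy = Sx ; Sz = Sz ; x≢y = x≢y ∘ sym ; y≢z = x≢z ; x≢z = y≢z
                      ; only = λ Sv → [ inj₂ ∘ inj₁ , [ inj₁ , inj₂ ∘ inj₂ ]′ ]′ (only Sv) }
      where open Triple T

    swap₂₃ : ∀ {x y z} → Triple x y z → Triple x z y
    swap₂₃ T = record { Sx = Sx ; Sy = Sz ; Sz = Sy ; x≢y = x≢z ; y≢z = y≢z ∘ sym ; x≢z = x≢y
                      ; only = λ Sv → [ inj₁ , [ inj₂ ∘ inj₂ , inj₂ ∘ inj₁ ]′ ]′ (only Sv) }
      where open Triple T

    module _ {x y z} (T : Triple x y z) where
      open Triple T

      three-connected : Adj x y → Adj y z → Outcome
      three-connected a b = inj₁ (_ , S-rep (x ∷ []) (Sx ∷ []) ([] ∷ []) (λ Sv → here (to (only Sv))) , shape)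
        where
        to : ∀ {v} → v ≡ x ⊎ v ≡ y ⊎ v ≡ z → Reach F x v
        to (inj₁ refl)        = here (proj₁ Sx)
        to (inj₂ (inj₁ refl)) = Reach-edge (proj₁ Sx) (proj₁ Sy) a
        to (inj₂ (inj₂ refl)) = step (proj₁ Sx) a (Reach-edge (proj₁ Sy) (proj₁ Sz) b)
        all : ∀ v → Reach F x v ⇔ (v ≡ x ⊎ v ≡ y ⊎ v ≡ z)
        all v = mk⇔ (stays (λ _ _ _ _ Sw → only Sw) Sx (inj₁ refl)) to
        shape : CompIsK1 F x ⊎ CompIsK2 F x ⊎ CompIsP3 F x ⊎ CompIsK3 F x
        shape with Adj? x z
        ... | yes c = inj₂ (inj₂ (inj₂ (x , y , z , x≢y , y≢z , x≢z , a , b , c , all)))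
        ... | no ¬c = inj₂ (inj₂ (inj₁ (x , y , z , x≢y , y≢z , x≢z , a , b , ¬c , all)))

      lone : ¬ Adj x y → ¬ Adj x z → CompIsK1 F x
      lone ¬xy ¬xz = isolated Sx λ w Sw a →
        [ (λ e → e) , [ (λ { refl → contradiction a ¬xy }) , (λ { refl → contradiction a ¬xz }) ]′ ]′ (only Sw)

      lone-edge : ¬ Adj x y → ¬ Adj x z → Adj y z → Outcome
      lone-edge ¬xy ¬xz b = inj₂ (inj₂ (inj₁ (_ , S-rep (x ∷ y ∷ []) (Sx ∷ Sy ∷ [])
        (((λ xy → x≢y (sym (lone ¬xy ¬xz y xy))) ∷ []) ∷ [] ∷ []) (λ Sv → cover (only Sv)) ,
        lone ¬xy ¬xz , y , z , y≢z , b , λ v → mk⇔ (stays next Sy (inj₁ refl)) to)))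
        where
        to : ∀ {v} → v ≡ y ⊎ v ≡ z → Reach F y v
        to (inj₁ refl) = here (proj₁ Sy)
        to (inj₂ refl) = Reach-edge (proj₁ Sy) (proj₁ Sz) b
        cover : ∀ {v} → v ≡ x ⊎ v ≡ y ⊎ v ≡ z → Any (λ u → Reach F u v) (x ∷ y ∷ [])
        cover (inj₁ refl) = here (here (proj₁ Sx))
        cover (inj₂ e)    = there (here (to e))
        next : ∀ u w → u ≡ y ⊎ u ≡ z → Adj u w → S w → w ≡ y ⊎ w ≡ z
        next u w e a Sw with only Sw
        next u w e           a Sw | inj₂ f    = f
        next u w (inj₁ refl) a Sw | inj₁ refl = contradiction (Adj-sym {u = y} {x} a) ¬xy
        next u w (inj₂ refl) a Sw | inj₁ refl = contradiction (Adj-sym {u = z} {x} a) ¬xz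

    three-lone : ∀ {x y z} → Triple x y z → ¬ Adj x y → ¬ Adj y z → ¬ Adj x z → Outcome
    three-lone {x} {y} {z} T ¬xy ¬yz ¬xz =
      inj₂ (inj₂ (inj₂ (_ , S-rep (x ∷ y ∷ z ∷ []) (Sx ∷ Sy ∷ Sz ∷ [])
        (((λ xy → x≢y (sym (Kx y xy))) ∷ (λ xz → x≢z (sym (Kx z xz))) ∷ []) ∷
         ((λ yz → y≢z (sym (Ky z yz))) ∷ []) ∷ [] ∷ [])
        (λ Sv → cover (only Sv)) , Kx , Ky ,
        lone (swap₁₂ (swap₂₃ T)) (¬xz ∘ Adj-sym {u = z} {x}) (¬yz ∘ Adj-sym {u = z} {y}))))
      where
      open Triple T
      Kx : CompIsK1 F x
      Kx = lone T ¬xy ¬xz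
      Ky : CompIsK1 F y
      Ky = lone (swap₁₂ T) (¬xy ∘ Adj-sym {u = y} {x}) ¬yz
      cover : ∀ {v} → v ≡ x ⊎ v ≡ y ⊎ v ≡ z → Any (λ u → Reach F u v) (x ∷ y ∷ z ∷ [])
      cover (inj₁ refl)        = here (here (proj₁ Sx))
      cover (inj₂ (inj₁ refl)) = there (here (here (proj₁ Sy)))
      cover (inj₂ (inj₂ refl)) = there (there (here (here (proj₁ Sz))))

    -- Up to relabelling only the number of edges matters: two or three give a connected triple, one
    -- gives an edge and a single vertex, none gives three single vertices.
    three : ∀ {x y z} → Triple x y z → Outcome
    three {x} {y} {z} T with Adj? x y | Adj? y z | Adj? x z
    ... | yes a | yes b | _     = three-connected T a b
    ... | yes a | no _  | yes c = three-connected (swap₁₂ T) (Adj-sym {u = x} {y} a) c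
    ... | no _  | yes b | yes c = three-connected (swap₂₃ T) c (Adj-sym {u = y} {z} b)
    ... | yes a | no ¬b | no ¬c = lone-edge (swap₁₂ (swap₂₃ T)) (¬c ∘ Adj-sym {u = z} {x}) (¬b ∘ Adj-sym {u = z} {y}) a
    ... | no ¬a | yes b | no ¬c = lone-edge T ¬a ¬c b
    ... | no ¬a | no ¬b | yes c = lone-edge (swap₁₂ T) (¬a ∘ Adj-sym {u = y} {x}) ¬b c
    ... | no ¬a | no ¬b | no ¬c = three-lone T ¬a ¬b ¬c

    classify : ∀ xs → length xs ≤ 3 → Unique xs → (∀ {v} → v ∈ xs → S v) → (∀ {v} → S v → v ∈ xs) →
      ∃ S → Outcome
    classify [] _ _ _ into (_ , Sv) with () ← into Sv
    classify (x ∷ []) _ _ out into _ = one (out (here refl)) λ Sv → only (into Sv)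
      where
      only : ∀ {v} → v ∈ x ∷ [] → v ≡ x
      only (here e) = e
    classify (x ∷ y ∷ []) _ ((x≢y ∷ []) ∷ _) out into _ =
      two (out (here refl)) (out (there (here refl))) x≢y λ Sv → only (into Sv)
      where
      only : ∀ {v} → v ∈ x ∷ y ∷ [] → v ≡ x ⊎ v ≡ y
      only (here e)         = inj₁ e
      only (there (here e)) = inj₂ e
    classify (x ∷ y ∷ z ∷ []) _ ((x≢y ∷ x≢z ∷ []) ∷ (y≢z ∷ []) ∷ _) out into _ = three record
      { Sx = out (here refl) ; Sy = out (there (here refl)) ; Sz = out (there (there (here refl)))
      ; x≢y = x≢y ; y≢z = y≢z ; x≢z = x≢z ; only = λ Sv → only (into Sv) }
      where
      only : ∀ {v} → v ∈ x ∷ y ∷ z ∷ [] → v ≡ x ⊎ v ≡ y ⊎ v ≡ z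
      only (here e)                 = inj₁ e
      only (there (here e))         = inj₂ (inj₁ e)
      only (there (there (here e))) = inj₂ (inj₂ e)
    classify (_ ∷ _ ∷ _ ∷ _ ∷ _) (s≤s (s≤s (s≤s ()))) _ _ _ _

-- Finding the giant component outside a small cut.

module SmallCut {t} (F : List (Vertex (3 + t))) (|F|≤ : length F ≤ 11 + 8 * t) where

  private
    n = 3 + t

  open DecMembership (_≟ⱽ_ {n}) using (_∈?_; _∉?_)
  open Components F

  alive : ℕ
  alive = size (_∉? F)

  3^≤ : 3 ^ n ≤ alive + (11 + 8 * t)
  3^≤ = begin
    3 ^ n                     ≡⟨ length-vertices n ⟨
    length (vertices n)       ≡⟨ cong length (filter-all always (All.universal (λ _ → tt) (vertices n))) ⟨
    size always               ≤⟨ count-∪ always (_∉? F) (_∈? F) (λ {v} _ → split v) (vertices n) ⟩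
    alive + size (_∈? F)      ≤⟨ +-monoʳ-≤ alive (≤-trans (count-∈ _≟ⱽ_ (vertices-unique n) F) |F|≤) ⟩
    alive + (11 + 8 * t)      ∎
    where
    open ≤-Reasoning
    always : Decidable {A = Vertex n} (λ _ → ⊤)
    always _ = yes tt
    split : ∀ v → v ∉ F ⊎ v ∈ F
    split v with v ∈? F
    ... | yes p = inj₂ p
    ... | no ¬p = inj₁ ¬p

  16≤alive : 16 ≤ alive
  16≤alive = +-cancelʳ-≤ (11 + 8 * t) _ _ (≤-trans (27+8t≤3^ t) 3^≤)

  alive≤ : ∀ {P} (P? : Decidable P) → alive ≤ size P? + size (Rest? P?)
  alive≤ {P} P? = count-∪ (_∉? F) P? (Rest? P?) (λ {v} → split v) (vertices n)
    where
    split : ∀ v → v ∉ F → P v ⊎ Rest P v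
    split v v∉F with P? v
    ... | yes p = inj₁ p
    ... | no ¬p = inj₂ (v∉F , ¬p)

  -- A closed set is apart from its rest. With 4 vertices in each, `apart-sizes` at `k = 4` would
  -- demand `12 + 8 * t` further vertices, one more than `F` can supply.
  dichotomy : ∀ {P} (P? : Decidable P) → Closed P → size P? ≤ 3 ⊎ size (Rest? P?) ≤ 3
  dichotomy {P} P? (alv , next) with size P? ≤? 3 | size (Rest? P?) ≤? 3
  ... | yes p | _     = inj₁ p
  ... | _     | yes q = inj₂ q
  ... | no ¬p | no ¬q = ⊥-elim (<-irrefl refl (begin-strict
    12 + 8 * t + alive                            ≤⟨ +-monoʳ-≤ (12 + 8 * t) (alive≤ P?) ⟩
    12 + 8 * t + (size P? + size (Rest? P?))      ≤⟨ sizes (≰⇒> ¬p) (≰⇒> ¬q) ⟩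
    3 ^ n                                         ≤⟨ 3^≤ ⟩
    alive + (11 + 8 * t)                          ≡⟨ +-comm alive _ ⟩
    11 + 8 * t + alive                            <⟨ ≤-refl ⟩
    12 + 8 * t + alive                            ∎))
    where
    open ≤-Reasoning
    ap : Apart P (Rest P)
    ap p (v∉F , ¬p) = (λ { refl → ¬p p }) , (λ a → ¬p (next p a v∉F))
    sizes : 4 ≤ size P? → 4 ≤ size (Rest? P?) → 12 + 8 * t + (size P? + size (Rest? P?)) ≤ 3 ^ n
    sizes = apart-sizes n P? (Rest? P?) ap (s≤s ≤-refl)

  -- Adding one component of at most 3 vertices to a union of at most 3 yields at most 6. If that
  -- missed at most 3, at most 9 vertices would survive, against `16≤alive`; so `dichotomy` brings
  -- the union back to at most 3.
  small-classes : (∀ {r} → r ∉ F → ¬ (size (Rest? (Reach? r)) ≤ 3)) →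
    ∀ rs → All (_∉ F) rs → size (λ v → Any.any? (λ r → Reach? r v) rs) ≤ 3
  small-classes none [] [] = ≤-trans (≤-reflexive (cong length
    (filter-none (λ v → Any.any? (λ r → Reach? r v) []) (All.universal (λ _ ()) (vertices n))))) z≤n
  small-classes none (r ∷ rs) (r∉F ∷ rs∉F) with dichotomy (Reach? r) (Reach-closed r)
  ... | inj₂ q = ⊥-elim (none r∉F q)
  ... | inj₁ p with dichotomy (λ v → Any.any? (λ r → Reach? r v) (r ∷ rs)) (Any-closed (r ∷ rs))
    where
    P? : Decidable (λ v → Any (λ r → Reach F r v) (r ∷ rs))
    P? v = Any.any? (λ r → Reach? r v) (r ∷ rs)
  ...   | inj₁ small = small
  ...   | inj₂ big = ⊥-elim (<⇒≱ (≤-trans (m≤m+n 10 6) 16≤alive) (begin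
    alive                               ≤⟨ alive≤ P? ⟩
    size P? + size (Rest? P?)           ≤⟨ +-mono-≤ (count-∪ P? (Reach? r) Q?
                                             (λ { (here p) → inj₁ p ; (there q) → inj₂ q }) (vertices n)) big ⟩
    size (Reach? r) + size Q? + 3       ≤⟨ +-monoˡ-≤ 3 (+-mono-≤ p (small-classes none rs rs∉F)) ⟩
    9                                   ∎))
    where
    open ≤-Reasoning
    P? : Decidable (λ v → Any (λ r → Reach F r v) (r ∷ rs))
    P? v = Any.any? (λ r → Reach? r v) (r ∷ rs)
    Q? : Decidable (λ v → Any (λ r → Reach F r v) rs)
    Q? v = Any.any? (λ r → Reach? r v) rs

  -- Otherwise `small-classes`, applied with every surviving vertex as a representative, would leave
  -- at most 3 survivors in all.
  giant : Σ (Vertex n) λ r → r ∉ F × size (Rest? (Reach? r)) ≤ 3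
  giant with Any.any? (λ r → r ∉? F ×-dec size (Rest? (Reach? r)) ≤? 3) (vertices n)
  ... | yes p = let r , _ , q = find p in r , q
  ... | no ¬p = ⊥-elim (<⇒≱ (≤-trans (m≤m+n 4 12) 16≤alive) (begin
    alive                         ≤⟨ alive≤ P? ⟩
    size P? + size (Rest? P?)     ≡⟨ cong (λ xs → size P? + length xs)
                                       (filter-none (Rest? P?) (All.universal covered (vertices n))) ⟩
    size P? + 0                   ≡⟨ +-identityʳ _ ⟩
    size P?                       ≤⟨ small-classes none rs (All.tabulate (λ v∈ → proj₂ (∈-filter⁻ (_∉? F) {xs = vertices n} v∈))) ⟩
    3                             ∎))
    where
    open ≤-Reasoning
    rs : List (Vertex n)
    rs = filter (_∉? F) (vertices n)
    P? : Decidable (λ v → Any (λ r → Reach F r v) rs)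
    P? v = Any.any? (λ r → Reach? r v) rs
    covered : ∀ v → ¬ Rest (λ v → Any (λ r → Reach F r v) rs) v
    covered v (v∉F , ¬p) = ¬p (lose (∈-filter⁺ (_∉? F) (∈-vertices v) v∉F) (here v∉F))
    none : ∀ {r} → r ∉ F → ¬ (size (Rest? (Reach? r)) ≤ 3)
    none {r} r∉F q = ¬p (lose (∈-vertices r) (r∉F , q))

  conclusion : IsVertexCut F → Case1 F ⊎ Case2 F ⊎ Case3 F ⊎ Case4 F
  conclusion (u , v , u∉F , v∉F , ¬uv) =
    let r , r∉F , small = giant
        R? = Rest? (Reach? r)
    in Minor.classify r∉F (filter R? (vertices n)) small (Unique.filter⁺ R? (vertices-unique n))
         (λ x∈ → proj₂ (∈-filter⁻ R? {xs = vertices n} x∈)) (λ Sx → ∈-filter⁺ R? (∈-vertices _) Sx) (missed r (Reach? r u))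
    where
    -- No component contains both separated vertices `u` and `v`, so the giant one misses one of
    -- them.
    missed : ∀ r → Dec (Reach F r u) → ∃ (Rest (Reach F r))
    missed r (no ¬ru) = u , u∉F , ¬ru
    missed r (yes ru) = v , v∉F , λ rv → ¬uv (Reach-trans (Reach-sym ru) rv)

theorem3p7 : (n : ℕ) → 3 ≤ n → (F : List (Vertex n)) → Unique F →
    IsVertexCut F → length F ≤ 8 * n ∸ 13 →
    Case1 F ⊎ Case2 F ⊎ Case3 F ⊎ Case4 F
theorem3p7 (suc (suc (suc t))) (s≤s (s≤s (s≤s z≤n))) F _ cut |F|≤ =
  -- Once `8 * (3 + t)` is rewritten as `24 + 8 * t`, subtracting 13 computes to `11 + 8 * t`.
  SmallCut.conclusion F (≤-trans |F|≤ (≤-reflexive (cong (_∸ 13) (eq t)))) cut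
  where
  eq : ∀ t → 8 * (3 + t) ≡ 24 + 8 * t
  eq = solve-∀
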